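{- Let $n$ be a positive integer with prime factorization $n = \prod_{j=1}^{s} p_j^{\nu_{p_j}(n)}$, where $p_1,\dots,p_s$ are the distinct primes dividing $n$. Then $$\nu_2(\sigma(n)) = \sum_{\substack{1\le i\le s\\ \nu_{p_i}(n)\ \text{odd}\\ p_i\ \text{odd}}} \nu_2\left(\frac{(\nu_{p_i}(n)+1)(p_i+1)}{2}\right).$$
   Context: For a prime $p$ and a positive integer $m$, $\nu_p(m)$ denotes the $p$-adic valuation of $m$, i.e. the exponent of the highest power of $p$ dividing $m$. $\sigma(n)$ denotes the sum of the positive divisors of $n$. An empty sum is $0$. -}

module Defs where

open import Data.Fin.Base using (Fin)
open import Data.List.Base using (filter; upTo; applyUpTo; map; tabulate; allFin)
open import Data.List.Extrema.Nat using (max)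
open import Data.Nat.Base using (ℕ; suc; _^_)
open import Data.Nat.Divisibility using (_∣_; _∣?_)
open import Data.Nat.ListAction using (sum; product)
open import Relation.Nullary using (¬_; ¬?)
open import Relation.Unary using (Pred; Decidable)

-- The largest k with p ^ k ∣ m, for p ≥ 2 and m ≥ 1: every such k satisfies
-- k < p ^ k ≤ m, so searching k ≤ m misses none, and k = 0 always qualifies.
-- The value has no meaning for p ≤ 1 or m = 0.
ν : ℕ → ℕ → ℕ
ν p m = max 0 (filter (λ k → (p ^ k) ∣? m) (upTo (suc m)))

σ : ℕ → ℕ
σ n = sum (filter (_∣? n) (applyUpTo suc n))

Odd : ℕ → Set
Odd m = ¬ (2 ∣ m)

odd? : Decidable Odd
odd? m = ¬? (2 ∣? m)

∏ : (s : ℕ) → (Fin s → ℕ) → ℕ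
∏ s f = product (tabulate f)

-- The sum of f i over those i : Fin s satisfying P.
∑ : ∀ {ℓ} (s : ℕ) {P : Pred (Fin s) ℓ} → Decidable P → (Fin s → ℕ) → ℕ
∑ s P? f = sum (map f (filter P? (allFin s)))

{-# OPTIONS --safe #-}

-- σ (∏ pᵢ ^ eᵢ) is the product of the sums 1 + pᵢ + … + pᵢ ^ eᵢ, so ν 2 (σ n) is
-- the sum of the valuations of these factors. A factor is odd when pᵢ = 2 or eᵢ
-- is even. When p and e = 2 j + 1 are odd, the factor is 1 + p times the sum
-- 1 + q + … + q ^ j with q = p², and since q ≡ 1 (mod 4) this last sum has the
-- same 2-adic valuation as its number of terms j + 1: pairing up the terms
-- replaces (q , j + 1) by (q² , (j + 1) / 2) and splits off 1 + q ≡ 2 (mod 4).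
module Submission where

open import Defs
open import Data.Fin.Base using (Fin)
open import Data.List.Base using (List; []; _∷_; _++_; map; filter; applyUpTo; upTo; allFin)
open import Data.List.Extrema.Nat using (max≈v⁺)
open import Data.List.Membership.Propositional using (_∈_)
open import Data.List.Membership.Propositional.Properties
open import Data.List.Membership.Propositional.Properties.WithK using (unique∧set⇒bag)
open import Data.List.Properties using (map-tabulate)
open import Data.List.Relation.Binary.BagAndSetEquality using (∼bag⇒↭)
open import Data.List.Relation.Binary.Permutation.Propositional using (_↭_)
open import Data.List.Relation.Unary.All as All using (All; []; _∷_)
open import Data.List.Relation.Unary.AllPairs using ([]; _∷_)
open import Data.List.Relation.Unary.Unique.Propositional using (Unique)
import Data.List.Relation.Unary.Unique.Propositional.Properties as Unique
open import Data.Nat.Base using (ℕ; zero; suc; NonZero; NonTrivial; _+_; _*_; _^_; _/_; _≤_; _<_; z≤n; s≤s; nonTrivial⇒nonZero; nonTrivial⇒n>1; ≢-nonZero; ≢-nonZero⁻¹)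
open import Data.Nat.Coprimality using (Coprime; coprime-divisor)
open import Data.Nat.Divisibility
open import Data.Nat.DivMod using (m*n/n≡m; /-congˡ)
open import Data.Nat.Induction using (<-rec)
open import Data.Nat.ListAction using (sum; product)
open import Data.Nat.ListAction.Properties using (sum-++; sum-↭)
open import Data.Nat.Primality using (Prime; euclidsLemma; prime⇒irreducible; prime⇒nonTrivial; prime⇒nonZero; prime[2]; ¬prime[1])
open import Data.Nat.Properties
open import Data.Nat.Tactic.RingSolver using (solve-∀)
open import Data.Product.Base using (∃; ∃₂; _×_; _,_; proj₂)
open import Data.Sum.Base using (_⊎_; inj₁; inj₂; [_,_]′)
open import Function.Base using (_∘_; id)
open import Function.Bundles using (mk⇔)
open import Function.Definitions using (Injective)
open import Level using (Level)
open import Relation.Binary.PropositionalEquality using (_≡_; _≢_; refl; sym; trans; cong; cong₂; subst; module ≡-Reasoning)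
open import Relation.Nullary using (¬_; yes; no; contradiction)
open import Relation.Nullary.Decidable using (_×-dec_)
open import Relation.Unary using (Pred; Decidable)

private
  variable
    a ℓ : Level
    A : Set a

-- Primes and divisibility.

∤⇒nonZero : ∀ {m n} → m ∤ n → NonZero n
∤⇒nonZero {m} m∤n = ≢-nonZero λ { refl → m∤n (m ∣0) }

prime∣^⇒∣ : ∀ {p} m k → Prime p → p ∣ m ^ k → p ∣ m
prime∣^⇒∣ m zero    pp p∣1 = contradiction (subst Prime (∣1⇒≡1 p∣1) pp) ¬prime[1]
prime∣^⇒∣ m (suc k) pp p∣  = [ id , prime∣^⇒∣ m k pp ]′ (euclidsLemma m (m ^ k) pp p∣)

prime∣prime⇒≡ : ∀ {p q} → Prime p → Prime q → p ∣ q → p ≡ q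
prime∣prime⇒≡ pp pq p∣q with prime⇒irreducible pq p∣q
... | inj₁ refl = contradiction pp ¬prime[1]
... | inj₂ p≡q  = p≡q

prime∤⇒coprime : ∀ {p d} → Prime p → p ∤ d → Coprime d p
prime∤⇒coprime pp p∤d (c∣d , c∣p) with prime⇒irreducible pp c∣p
... | inj₁ c≡1  = c≡1
... | inj₂ refl = contradiction c∣d p∤d

coprime-divisor-^ : ∀ {d p m} k → Coprime d p → d ∣ p ^ k * m → d ∣ m
coprime-divisor-^ {m = m} zero    c d∣ = subst (_ ∣_) (*-identityˡ m) d∣
coprime-divisor-^ {d} {p} {m} (suc k) c d∣ =
  coprime-divisor-^ k c (coprime-divisor {o = p ^ k * m} c (subst (d ∣_) (*-assoc p (p ^ k) m) d∣))

-- Valuations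

n<m^n : ∀ m n .{{_ : NonTrivial m}} → n < m ^ n
n<m^n m zero    = s≤s z≤n
n<m^n m (suc n) = ≤-<-trans (n<m^n m n) (^-monoʳ-< m (nonTrivial⇒n>1 m) (n<1+n n))

-- This pins down `ν`: later arguments only exhibit such a factorization and never return to the
-- search in the definition.
ν-^* : ∀ p k q .{{_ : NonTrivial p}} → p ∤ q → ν p (p ^ k * q) ≡ k
ν-^* p k q p∤q = max≈v⁺ {⊤ = 0} k∈ (All.tabulate λ j∈ → ≤k (proj₂ (∈-filter⁻ div? {xs = upTo (suc (p ^ k * q))} j∈))) z≤n
  where
  instance
    p≢0 : NonZero p
    p≢0 = nonTrivial⇒nonZero p
    q≢0 : NonZero q
    q≢0 = ∤⇒nonZero p∤q
    p^k≢0 : NonZero (p ^ k)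
    p^k≢0 = m^n≢0 p k

  div? : Decidable (λ j → p ^ j ∣ p ^ k * q)
  div? j = (p ^ j) ∣? (p ^ k * q)

  k∈ : k ∈ filter div? (upTo (suc (p ^ k * q)))
  k∈ = ∈-filter⁺ div?
    -- The search includes `p ^ k * q` itself, and `k < p ^ k ≤ p ^ k * q` keeps `k` in range.
    (∈-upTo⁺ (s≤s (≤-trans (<⇒≤ (n<m^n p k)) (m≤m*n (p ^ k) q))))
    (m∣m*n q)

  ≤k : ∀ {j} → p ^ j ∣ p ^ k * q → j ≤ k
  -- If `k < j`, then `p ^ suc k` divides `p ^ k * q`, and cancelling `p ^ k` leaves `p ∣ q`.
  ≤k {j} p^j∣ = ≮⇒≥ λ k<j → p∤q (*-cancelˡ-∣ (p ^ k)
    (subst (_∣ p ^ k * q) (*-comm p (p ^ k)) (∣-trans (^-monoʳ-∣ k<j) p^j∣)))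
    where
    ^-monoʳ-∣ : ∀ {i j} → i ≤ j → p ^ i ∣ p ^ j
    ^-monoʳ-∣ {i} i≤j = subst (λ x → p ^ i ∣ p ^ x) (m+[n∸m]≡n i≤j)
      (subst (p ^ i ∣_) (sym (^-distribˡ-+-* p i _)) (m∣m*n _))

∤⇒ν≡0 : ∀ {p m} .{{_ : NonTrivial p}} → p ∤ m → ν p m ≡ 0
∤⇒ν≡0 {p} {m} p∤m = trans (cong (ν p) (sym (*-identityˡ m))) (ν-^* p 0 m p∤m)

factor-out : ∀ p m .{{_ : NonTrivial p}} .{{_ : NonZero m}} →
             ∃₂ λ k q → p ∤ q × m ≡ p ^ k * q
factor-out p m = <-rec Factored step m
  where
  Factored : ℕ → Set
  Factored m = .{{_ : NonZero m}} → ∃₂ λ k q → p ∤ q × m ≡ p ^ k * q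

  step : ∀ m → (∀ {i} → i < m → Factored i) → Factored m
  step m rec with p ∣? m
  ... | no  p∤m = 0 , m , p∤m , sym (*-identityˡ m)
  ... | yes p∣m with rec (quotient-< p∣m) {{quotient≢0 p∣m}}
  ...   | k , q , p∤q , eq = suc k , q , p∤q , (begin
          m                 ≡⟨ m∣n⇒n≡m*quotient p∣m ⟩
          p * quotient p∣m  ≡⟨ cong (p *_) eq ⟩
          p * (p ^ k * q)   ≡⟨ *-assoc p (p ^ k) q ⟨
          p ^ suc k * q     ∎)
          where open ≡-Reasoning

-- Once the full power of `p` is split off each factor, exponents add. Primality enters through
-- Euclid's lemma: `p` does not divide the product of the two cofactors.
ν-* : ∀ {p} m n .{{_ : NonZero m}} .{{_ : NonZero n}} → Prime p →
      ν p (m * n) ≡ ν p m + ν p n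
ν-* {p} m n pp with factor-out p m {{prime⇒nonTrivial pp}} | factor-out p n {{prime⇒nonTrivial pp}}
... | k , q , p∤q , refl | l , r , p∤r , refl = begin
  ν p (p ^ k * q * (p ^ l * r))         ≡⟨ cong (ν p) ([m*n]*[o*p]≡[m*o]*[n*p] (p ^ k) q (p ^ l) r) ⟩
  ν p (p ^ k * p ^ l * (q * r))         ≡⟨ cong (λ x → ν p (x * (q * r))) (^-distribˡ-+-* p k l) ⟨
  ν p (p ^ (k + l) * (q * r))           ≡⟨ ν-^* p (k + l) (q * r) ([ p∤q , p∤r ]′ ∘ euclidsLemma q r pp) ⟩
  k + l                                 ≡⟨ cong₂ _+_ (ν-^* p k q p∤q) (ν-^* p l r p∤r) ⟨
  ν p (p ^ k * q) + ν p (p ^ l * r)     ∎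
  where
  open ≡-Reasoning
  instance
    _ = prime⇒nonTrivial pp

product-map-nonZero : (f : A → ℕ) → (∀ x → NonZero (f x)) → ∀ xs → NonZero (product (map f xs))
product-map-nonZero f f≢0 []       = _
product-map-nonZero f f≢0 (x ∷ xs) = m*n≢0 _ _ {{f≢0 x}} {{product-map-nonZero f f≢0 xs}}

ν-product : ∀ {p} → Prime p → (f : A → ℕ) → (∀ x → NonZero (f x)) → ∀ xs →
            ν p (product (map f xs)) ≡ sum (map (ν p ∘ f) xs)
ν-product {p = p} pp f f≢0 []       =
  ∤⇒ν≡0 {p} {{prime⇒nonTrivial pp}} λ p∣1 → ¬prime[1] (subst Prime (∣1⇒≡1 p∣1) pp)
ν-product {p = p} pp f f≢0 (x ∷ xs) =
  trans (ν-* (f x) (product (map f xs)) {{f≢0 x}} {{product-map-nonZero f f≢0 xs}} pp)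
        (cong (ν p (f x) +_) (ν-product pp f f≢0 xs))

-- The sum of divisors

divisors : ℕ → List ℕ
divisors n = filter (_∣? n) (applyUpTo suc n)

∈-divisors⁺ : ∀ {d n} .{{_ : NonZero n}} → d ∣ n → d ∈ divisors n
∈-divisors⁺ {zero}  {n} d∣n = contradiction (0∣⇒≡0 d∣n) (≢-nonZero⁻¹ n)
∈-divisors⁺ {suc d} {n} d∣n = ∈-filter⁺ (_∣? n) (∈-applyUpTo⁺ suc (∣⇒≤ d∣n)) d∣n

∈-divisors⁻ : ∀ {d} n → d ∈ divisors n → d ∣ n
∈-divisors⁻ n d∈ = proj₂ (∈-filter⁻ (_∣? n) {xs = applyUpTo suc n} d∈)

divisors-unique : ∀ n → Unique (divisors n)
divisors-unique n = Unique.filter⁺ (_∣? n)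
  (Unique.applyUpTo⁺₁ suc n λ i<j _ eq → <⇒≢ i<j (suc-injective eq))

-- A divisor not divisible by `p` is coprime to it and so divides `m`; any other is `p` times a
-- divisor of `p ^ k * m`. Neither side repeats an entry, so having the same members makes them
-- permutations of each other.
divisors-p*p^k*m : ∀ {p m} k → Prime p → p ∤ m →
  divisors (p ^ suc k * m) ↭ divisors m ++ map (p *_) (divisors (p ^ k * m))
divisors-p*p^k*m {p} {m} k pp p∤m = ∼bag⇒↭ (unique∧set⇒bag
  (divisors-unique (p ^ suc k * m))
  (Unique.++⁺ (divisors-unique m)
    (Unique.map⁺ (λ {x} {y} → *-cancelˡ-≡ x y p) (divisors-unique (p ^ k * m)))
    disjoint)
  (mk⇔ to from))
  where
  instance
    p≢0 : NonZero p
    p≢0 = prime⇒nonZero pp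
    m≢0 : NonZero m
    m≢0 = ∤⇒nonZero p∤m
    p^k*m≢0 : ∀ {j} → NonZero (p ^ j * m)
    p^k*m≢0 {j} = m*n≢0 (p ^ j) m {{m^n≢0 p j}}

  disjoint : ∀ {d} → ¬ (d ∈ divisors m × d ∈ map (p *_) (divisors (p ^ k * m)))
  disjoint (d∈ , d∈′) with ∈-map⁻ (p *_) d∈′
  ... | e , _ , refl = p∤m (∣-trans (m∣m*n e) (∈-divisors⁻ m d∈))

  assoc : p ^ suc k * m ≡ p * (p ^ k * m)
  assoc = *-assoc p (p ^ k) m

  to : ∀ {d} → d ∈ divisors (p ^ suc k * m) →
       d ∈ divisors m ++ map (p *_) (divisors (p ^ k * m))
  to {d} d∈ with p ∣? d | ∈-divisors⁻ (p ^ suc k * m) d∈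
  ... | no  p∤d | d∣ = ∈-++⁺ˡ (∈-divisors⁺ (coprime-divisor-^ (suc k) (prime∤⇒coprime pp p∤d) d∣))
  ... | yes (divides e refl) | d∣ = ∈-++⁺ʳ (divisors m)
    (subst (_∈ map (p *_) (divisors (p ^ k * m))) (*-comm p e)
      (∈-map⁺ (p *_) (∈-divisors⁺ {{p^k*m≢0 {k}}}
        (*-cancelˡ-∣ p (subst (_∣ p * (p ^ k * m)) (*-comm e p) (subst (e * p ∣_) assoc d∣))))))

  from : ∀ {d} → d ∈ divisors m ++ map (p *_) (divisors (p ^ k * m)) →
         d ∈ divisors (p ^ suc k * m)
  from d∈ with ∈-++⁻ (divisors m) d∈
  ... | inj₁ d∈m = ∈-divisors⁺ {{p^k*m≢0 {suc k}}} (∣n⇒∣m*n (p ^ suc k) (∈-divisors⁻ m d∈m))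
  ... | inj₂ d∈′ with ∈-map⁻ (p *_) d∈′
  ...   | e , e∈ , refl = ∈-divisors⁺ {{p^k*m≢0 {suc k}}}
          (subst (p * e ∣_) (sym assoc) (*-monoʳ-∣ p (∈-divisors⁻ (p ^ k * m) e∈)))

sum-map-* : ∀ c ns → sum (map (c *_) ns) ≡ c * sum ns
sum-map-* c []       = sym (*-zeroʳ c)
sum-map-* c (n ∷ ns) = trans (cong (c * n +_) (sum-map-* c ns)) (sym (*-distribˡ-+ c n (sum ns)))

-- geom q k = 1 + q + … + q ^ k, with k + 1 terms.
geom : ℕ → ℕ → ℕ
geom q zero    = 1
geom q (suc k) = 1 + q * geom q k

geom-nonZero : ∀ q k → NonZero (geom q k)
geom-nonZero q zero    = _
geom-nonZero q (suc k) = _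

-- Summing the split list of divisors gives `σ m + p * σ (p ^ k * m)`, which is the recursion of
-- `geom`, in Horner form, multiplied by `σ m`.
σ-p^k*m : ∀ {p m} k → Prime p → p ∤ m → σ (p ^ k * m) ≡ geom p k * σ m
σ-p^k*m {p} {m} zero    pp p∤m = trans (cong σ (*-identityˡ m)) (sym (*-identityˡ (σ m)))
σ-p^k*m {p} {m} (suc k) pp p∤m = begin
  σ (p ^ suc k * m)                                            ≡⟨ sum-↭ (divisors-p*p^k*m k pp p∤m) ⟩
  sum (divisors m ++ map (p *_) (divisors (p ^ k * m)))        ≡⟨ sum-++ (divisors m) _ ⟩
  σ m + sum (map (p *_) (divisors (p ^ k * m)))                ≡⟨ cong (σ m +_) (sum-map-* p (divisors (p ^ k * m))) ⟩
  σ m + p * σ (p ^ k * m)                                      ≡⟨ cong (λ x → σ m + p * x) (σ-p^k*m k pp p∤m) ⟩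
  σ m + p * (geom p k * σ m)                                   ≡⟨ cong (σ m +_) (*-assoc p (geom p k) (σ m)) ⟨
  geom p (suc k) * σ m                                         ∎
  where open ≡-Reasoning

prime∤product : ∀ {p} (b e : A → ℕ) → Prime p → (∀ x → Prime (b x)) →
                ∀ {xs} → All (λ x → p ≢ b x) xs →
                p ∤ product (map (λ x → b x ^ e x) xs)
prime∤product b e pp bp []           p∣1 = contradiction (subst Prime (∣1⇒≡1 p∣1) pp) ¬prime[1]
prime∤product b e pp bp {x ∷ xs} (p≢bx ∷ ≢s) p∣ with euclidsLemma (b x ^ e x) _ pp p∣
... | inj₁ p∣head = p≢bx (prime∣prime⇒≡ pp (bp x) (prime∣^⇒∣ (b x) (e x) pp p∣head))
... | inj₂ p∣tail = prime∤product b e pp bp ≢s p∣tail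

-- Prime powers are split off one at a time; injectivity of `p` and distinctness of the indices keep
-- the head prime from dividing the product over the tail.
σ-product : (p e : A → ℕ) → (∀ x → Prime (p x)) → Injective _≡_ _≡_ p →
            ∀ {xs} → Unique xs →
            σ (product (map (λ x → p x ^ e x) xs)) ≡ product (map (λ x → geom (p x) (e x)) xs)
σ-product p e pp inj []                = refl
σ-product p e pp inj {x ∷ xs} (x∉ ∷ u) = trans
  (σ-p^k*m (e x) (pp x) (prime∤product p e (pp x) pp (All.map (_∘ inj) x∉)))
  (cong (geom (p x) (e x) *_) (σ-product p e pp inj u))

-- Parity of geometric sums

even⇒odd-suc : ∀ {m} → 2 ∣ m → Odd (suc m)
even⇒odd-suc {m} 2∣m 2∣1+m with ∣1⇒≡1 (∣m+n∣m⇒∣n (subst (2 ∣_) (+-comm 1 m) 2∣1+m) 2∣m)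
... | ()

-- Writing `j * 2` lets `suc j * 2` reduce to `suc (suc (j * 2))`, so that `geom` unfolds at these
-- exponents.
even⊎odd : ∀ n → (∃ λ j → n ≡ j * 2) ⊎ (∃ λ j → n ≡ suc (j * 2))
even⊎odd zero = inj₁ (0 , refl)
even⊎odd (suc n) with even⊎odd n
... | inj₁ (j , refl) = inj₂ (j , refl)
... | inj₂ (j , refl) = inj₁ (suc j , refl)

-- The terms of exponents `2 * i` and `2 * i + 1` add up to `(1 + q) * (q * q) ^ i`.
geom-pair : ∀ q j → geom q (suc (j * 2)) ≡ (1 + q) * geom (q * q) j
geom-pair q zero    = identity q
  where
  identity : ∀ q → 1 + q * 1 ≡ (1 + q) * 1
  identity = solve-∀
geom-pair q (suc j) = trans
  (cong (λ x → 1 + q * (1 + q * x)) (geom-pair q j))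
  (identity q (geom (q * q) j))
  where
  identity : ∀ q g → 1 + q * (1 + q * ((1 + q) * g)) ≡ (1 + q) * (1 + q * q * g)
  identity = solve-∀

geom-even-base : ∀ {q} k → 2 ∣ q → Odd (geom q k)
geom-even-base zero    2∣q = even⇒odd-suc (2 ∣0)
geom-even-base (suc k) 2∣q = even⇒odd-suc (∣m⇒∣m*n _ 2∣q)

-- After the leading 1 comes `q` times a sum with an even number of terms, which pairing makes a
-- multiple of the even number `1 + q`.
geom-even-exponent : ∀ {q} j → 2 ∣ suc q → Odd (geom q (j * 2))
geom-even-exponent     zero    2∣1+q = even⇒odd-suc (2 ∣0)
geom-even-exponent {q} (suc j) 2∣1+q = even⇒odd-suc
  (∣n⇒∣m*n q (subst (2 ∣_) (sym (geom-pair q j)) (∣m⇒∣m*n _ 2∣1+q)))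

-- The induction on `j` keeps `r` general because pairing replaces the base `q` by `q * q`.
ν₂-geom-1mod4 : ∀ j r → ν 2 (geom (1 + r * 4) j) ≡ ν 2 (suc j)
ν₂-geom-1mod4 = <-rec _ step
  where
  step : ∀ j → (∀ {i} → i < j → ∀ r → ν 2 (geom (1 + r * 4) i) ≡ ν 2 (suc i)) →
         ∀ r → ν 2 (geom (1 + r * 4) j) ≡ ν 2 (suc j)
  step j rec r with even⊎odd j
  -- The number of terms is odd and so is the sum: both valuations are 0.
  ... | inj₁ (i , refl) = trans
    (∤⇒ν≡0 (geom-even-exponent i (divides (1 + r * 2) (identity r))))
    (sym (∤⇒ν≡0 (even⇒odd-suc (n∣m*n i))))
    where
    identity : ∀ r → 2 + r * 4 ≡ (1 + r * 2) * 2
    identity = solve-∀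
  ... | inj₂ (i , refl) = begin
    ν 2 (geom q (suc (i * 2)))              ≡⟨ cong (ν 2) (geom-pair q i) ⟩
    ν 2 ((1 + q) * geom (q * q) i)          ≡⟨ ν-* (1 + q) (geom (q * q) i) {{_}} {{geom-nonZero (q * q) i}} prime[2] ⟩
    ν 2 (1 + q) + ν 2 (geom (q * q) i)      ≡⟨ cong₂ _+_ ν[1+q]≡1 (cong (λ x → ν 2 (geom x i)) (square r)) ⟩
    1 + ν 2 (geom (1 + (r * 2 + r * r * 4) * 4) i)  ≡⟨ cong (1 +_) (rec (s≤s (m≤m*n i 2)) (r * 2 + r * r * 4)) ⟩
    -- The 1 that came from `1 + q` is now read as `ν 2 2`, and `2 * suc i` is the original number
    -- of terms.
    1 + ν 2 (suc i)                         ≡⟨ ν-* 2 (suc i) prime[2] ⟨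
    ν 2 (2 * suc i)                         ≡⟨ cong (ν 2) (*-comm 2 (suc i)) ⟩
    ν 2 (suc (suc (i * 2)))                 ∎
    where
    open ≡-Reasoning
    q = 1 + r * 4

    square : ∀ r → (1 + r * 4) * (1 + r * 4) ≡ 1 + (r * 2 + r * r * 4) * 4
    square = solve-∀

    half : ∀ r → 2 + r * 4 ≡ 2 ^ 1 * (1 + r * 2)
    half = solve-∀

    ν[1+q]≡1 : ν 2 (1 + q) ≡ 1
    -- As `q` is 1 modulo 4, `1 + q` is twice an odd number.
    ν[1+q]≡1 = trans (cong (ν 2) (half r)) (ν-^* 2 1 (1 + r * 2) (even⇒odd-suc (n∣m*n r)))

-- Here `k + 1` is `2 * suc j`, so pairing leaves `1 + p` times a sum of `suc j` terms to the base
-- `p * p`. An odd square is 1 modulo 4, so that sum has the valuation of `suc j`.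
ν₂-geom-odd : ∀ p k → Odd k → Odd p → ν 2 (geom p k) ≡ ν 2 (((k + 1) * (p + 1)) / 2)
ν₂-geom-odd p k k-odd p-odd with even⊎odd k | even⊎odd p
... | inj₁ (j , refl) | _               = contradiction (n∣m*n j) k-odd
... | inj₂ _          | inj₁ (c , refl) = contradiction (n∣m*n c) p-odd
... | inj₂ (j , refl) | inj₂ (c , refl) = begin
  ν 2 (geom p (suc (j * 2)))                        ≡⟨ cong (ν 2) (geom-pair p j) ⟩
  ν 2 ((1 + p) * geom (p * p) j)                    ≡⟨ ν-* (1 + p) (geom (p * p) j) {{_}} {{geom-nonZero (p * p) j}} prime[2] ⟩
  ν 2 (1 + p) + ν 2 (geom (p * p) j)                ≡⟨ cong (λ x → ν 2 (1 + p) + ν 2 (geom x j)) (square c) ⟩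
  ν 2 (1 + p) + ν 2 (geom (1 + (c + c * c) * 4) j)  ≡⟨ cong (ν 2 (1 + p) +_) (ν₂-geom-1mod4 j (c + c * c)) ⟩
  ν 2 (1 + p) + ν 2 (suc j)                         ≡⟨ ν-* (1 + p) (suc j) prime[2] ⟨
  -- Doubling and then halving shows that the division in the goal is exact.
  ν 2 ((1 + p) * suc j)                             ≡⟨ cong (ν 2) (m*n/n≡m ((1 + p) * suc j) 2) ⟨
  ν 2 ((1 + p) * suc j * 2 / 2)                     ≡⟨ cong (ν 2) (/-congˡ {o = 2} (rearrange p j)) ⟩
  ν 2 ((suc (j * 2) + 1) * (p + 1) / 2)             ∎
  where
  open ≡-Reasoning

  square : ∀ c → suc (c * 2) * suc (c * 2) ≡ 1 + (c + c * c) * 4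
  square = solve-∀

  rearrange : ∀ p j → (1 + p) * suc j * 2 ≡ (suc (j * 2) + 1) * (p + 1)
  rearrange = solve-∀

-- For even `p` all terms but the first are even; for odd `p` and even `k` there is an odd number of
-- odd terms.
ν₂-geom-zero : ∀ p k → ¬ (Odd k × Odd p) → ν 2 (geom p k) ≡ 0
ν₂-geom-zero p k ¬odds with even⊎odd k | even⊎odd p
... | _               | inj₁ (c , refl) = ∤⇒ν≡0 (geom-even-base k (n∣m*n c))
... | inj₁ (j , refl) | inj₂ (c , refl) = ∤⇒ν≡0 (geom-even-exponent j (n∣m*n (suc c)))
... | inj₂ (j , refl) | inj₂ (c , refl) =
  contradiction (even⇒odd-suc (n∣m*n j) , even⇒odd-suc (n∣m*n c)) ¬odds

-- Dropping the vanishing terms and assembling the formula.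

sum-map-filter : {P : Pred A ℓ} (P? : Decidable P) (f g : A → ℕ) →
                 (∀ x → P x → f x ≡ g x) → (∀ x → ¬ P x → f x ≡ 0) →
                 ∀ xs → sum (map f xs) ≡ sum (map g (filter P? xs))
sum-map-filter P? f g f≡g f≡0 []       = refl
sum-map-filter P? f g f≡g f≡0 (x ∷ xs) with P? x
... | yes px = cong₂ _+_ (f≡g x px) (sum-map-filter P? f g f≡g f≡0 xs)
... | no ¬px = cong₂ _+_ (f≡0 x ¬px) (sum-map-filter P? f g f≡g f≡0 xs)

theorem1p1 : (n : ℕ) .{{_ : NonZero n}} (s : ℕ) (p : Fin s → ℕ) →
    (∀ j → Prime (p j)) →
    (∀ j → p j ∣ n) →
    Injective _≡_ _≡_ p →
    n ≡ ∏ s (λ j → p j ^ ν (p j) n) →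
    -- the division by 2 is exact: both factors are even for every i summed over
    ν 2 (σ n) ≡ ∑ s (λ i → odd? (ν (p i) n) ×-dec odd? (p i)) (λ i → ν 2 (((ν (p i) n + 1) * (p i + 1)) / 2))
theorem1p1 n s p prime _ injective n≡∏ = begin
  ν 2 (σ n)                                                        ≡⟨ cong (ν 2 ∘ σ) n≡∏ ⟩
  ν 2 (σ (∏ s (λ j → p j ^ e j)))                                  ≡⟨ cong (ν 2 ∘ σ ∘ product) (map-tabulate id (λ j → p j ^ e j)) ⟨
  ν 2 (σ (product (map (λ j → p j ^ e j) (allFin s))))             ≡⟨ cong (ν 2) (σ-product p e prime injective (Unique.allFin⁺ s)) ⟩
  ν 2 (product (map (λ j → geom (p j) (e j)) (allFin s)))          ≡⟨ ν-product prime[2] _ (λ j → geom-nonZero (p j) (e j)) (allFin s) ⟩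
  sum (map (λ j → ν 2 (geom (p j) (e j))) (allFin s))              ≡⟨ sum-map-filter _ _ _
                                                                       (λ j (e-odd , p-odd) → ν₂-geom-odd (p j) (e j) e-odd p-odd)
                                                                       (λ j → ν₂-geom-zero (p j) (e j))
                                                                       (allFin s) ⟩
  ∑ s (λ i → odd? (e i) ×-dec odd? (p i)) (λ i → ν 2 (((e i + 1) * (p i + 1)) / 2)) ∎
  where
  open ≡-Reasoning
  -- The exponents stay tied to the original `n`, so rewriting `n` as a product under `σ` leaves
  -- them unchanged.
  e : Fin s → ℕ
  e j = ν (p j) n
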